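{- Let $n\geq 1$ be an integer. The number of elements $(a,b,c,d)\in\mathbb N^4$ such that $n=ab-cd$ and $\min(a,b)>\max(c,d)$ is given by $$\sum_{d\mid n,\ d^2\geq n}\left(d+1-\frac{n}{d}\right),$$ where the sum runs over all positive divisors $d$ of $n$ with $d^2\geq n$. Moreover, the map $$(a,b,c,d)\longmapsto \begin{pmatrix} a & c\\ d & b\end{pmatrix}$$ is a one-to-one correspondence between such solutions $(a,b,c,d)$ and elements of the set $\mathcal R(n)$ of Euclid-reduced matrices having determinant $n$.
   Context: $\mathbb N=\{0,1,2,\ldots\}$ denotes the set of all non-negative integers. $\mathcal P$ denotes the set of all $2\times 2$ matrices with entries in $\mathbb N$ and strictly positive determinant. An elementary reduction of a $2\times 2$ matrix $M$ is a matrix in $\{EM,E^tM,ME,ME^t\}$, where $E=\begin{pmatrix}1&-1\\0&1\end{pmatrix}$ and $E^t$ is its transpose (that is, elementary reductions subtract a row, respectively column, of $M$ from the other row, respectively column). A matrix $M\in\mathcal P$ is Euclid-reduced if and only if $\mathcal P$ contains no elementary reduction of $M$. Equivalently, $M=\begin{pmatrix}\alpha&\beta\\\gamma&\delta\end{pmatrix}\in\mathcal P$ is Euclid-reduced if $\min(\alpha,\delta)>\max(\beta,\gamma)$. $\mathcal R(n)$ denotes the set of all Euclid-reduced matrices in $\mathcal P$ of determinant $n$. -}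

module Defs where

open import Data.Nat.Base as ℕ using (ℕ; suc; _⊓_; _⊔_)
open import Data.Nat.Divisibility using (_∣_; _∣?_)
open import Data.Nat.DivMod using (_/_)
open import Data.Nat.ListAction using (sum)
import Data.Nat.Properties as ℕ
open import Data.Integer.Base as ℤ using (ℤ; +_; 0ℤ; 1ℤ; -1ℤ; _+_; _-_; _*_)
open import Data.List.Base using (List; []; _∷_; filter; map; upTo)
open import Data.List.Membership.Propositional using (_∈_)
open import Data.Product.Base using (_×_; _,_)
open import Data.Refinement using (Refinement; Refinement-syntax)
open import Relation.Binary.PropositionalEquality using (_≡_)
open import Relation.Nullary using (¬_)
open import Relation.Nullary.Decidable using (_×-dec_)

-- mat α β γ δ has rows (α , β) and (γ , δ).
record Matrix : Set where
  constructor mat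
  field
    α β γ δ : ℤ

infixl 7 _·_

_·_ : Matrix → Matrix → Matrix
mat a b c d · mat a′ b′ c′ d′ =
  mat (a * a′ + b * c′) (a * b′ + b * d′)
      (c * a′ + d * c′) (c * b′ + d * d′)

_ᵗ : Matrix → Matrix
mat a b c d ᵗ = mat a c b d

det : Matrix → ℤ
det (mat a b c d) = a * d - b * c

E : Matrix
E = mat 1ℤ -1ℤ
        0ℤ 1ℤ

-- Matrices live over ℤ because E and the elementary reductions may have
-- negative entries; membership in 𝒫 asks for entries in ℕ.
record 𝒫 (M : Matrix) : Set where
  open Matrix M
  field
    0≤α   : 0ℤ ℤ.≤ α
    0≤β   : 0ℤ ℤ.≤ β
    0≤γ   : 0ℤ ℤ.≤ γ
    0≤δ   : 0ℤ ℤ.≤ δ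
    0<det : 0ℤ ℤ.< det M

elementaryReductions : Matrix → List Matrix
elementaryReductions M = E · M ∷ E ᵗ · M ∷ M · E ∷ M · E ᵗ ∷ []

EuclidReduced : Matrix → Set
EuclidReduced M = 𝒫 M × (∀ N → N ∈ elementaryReductions M → ¬ 𝒫 N)

-- Sets of solutions and of matrices are refinement types, whose membership
-- proofs are irrelevant: elements are equal iff their underlying values are.
ℛ : ℕ → Set
ℛ n = [ M ∈ Matrix ∣ (EuclidReduced M × det M ≡ + n) ]

ℕ⁴ : Set
ℕ⁴ = ℕ × ℕ × ℕ × ℕ

-- The equation is read in ℤ, where a b - c d is not truncated.
IsSolution : ℕ → ℕ⁴ → Set
IsSolution n (a , b , c , d) =
  + n ≡ + a * + b - + c * + d × c ⊔ d ℕ.< a ⊓ b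

Solution : ℕ → Set
Solution n = [ s ∈ ℕ⁴ ∣ IsSolution n s ]

toMatrix : ℕ⁴ → Matrix
toMatrix (a , b , c , d) = mat (+ a) (+ c) (+ d) (+ b)

-- For n ≥ 1, every positive divisor of n is suc k for a unique k < n.
-- The subtraction is exact: n ≤ d * d gives n / d ≤ d.
divisorSum : ℕ → ℕ
divisorSum n = sum (map (λ k → term (suc k)) (filter (λ k → cond? (suc k)) (upTo n)))
  where
  cond? = λ d → (d ∣? n) ×-dec (n ℕ.≤? d ℕ.* d)

  term : (d : ℕ) .{{_ : ℕ.NonZero d}} → ℕ
  term d = (d ℕ.+ 1) ℕ.∸ n / d

{-# OPTIONS --safe #-}

-- View a solution as the pair of columns v = (a , d), w = (c , b) of its
-- matrix. Among nonnegative matrices of determinant n with a > d and b > c,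
-- replace v by v + w when a - d > b - c, and w by v + w when a - d < b - c: this
-- is the subtractive Euclidean algorithm on (a - d , b - c). Each such matrix
-- has at most one predecessor, and none exactly when min (a , b) > max (c , d),
-- so following the orbits matches the solutions with the end points of the
-- algorithm, where a - d = b - c = f. There n = f e with e = a + c, and 0 ≤ d ≤ e - f
-- is the only freedom left: every divisor e ≥ f = n / e gives e + 1 - n / e end points.
module Submission where

open import Defs
open import Data.Fin.Base using (Fin; zero; suc)
open import Data.Integer.Base as ℤ using (ℤ; +_; 0ℤ; 1ℤ; -1ℤ)
import Data.Integer.Properties as ℤ
import Data.Integer.Tactic.RingSolver as ℤ-Solver
open import Data.Irrelevant as Irrelevant using (Irrelevant; [_])
open import Data.List.Base using (List; []; _∷_; _++_; filter; map; upTo; lookup; length)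
open import Data.List.Membership.Propositional using (_∈_)
open import Data.List.Membership.Propositional.Properties
open import Data.List.Properties using (length-++; length-map; length-upTo)
import Data.List.Relation.Unary.All as All
open import Data.List.Relation.Unary.Any using (here; there; index)
open import Data.List.Relation.Unary.Any.Properties using (lookup-index)
open import Data.List.Relation.Unary.Unique.Propositional using (Unique; []; _∷_)
import Data.List.Relation.Unary.Unique.Propositional.Properties as Unique
open import Data.Nat.Base using (ℕ; zero; suc; pred; _+_; _*_; _∸_; _⊔_; _⊓_; _≤_; _<_; _≥_; s≤s; z≤n)
open import Data.Nat.Divisibility using (_∣_; _∣?_; divides)
open import Data.Nat.DivMod using (_/_; m*n/n≡m)
open import Data.Nat.Induction using (<-wellFounded)
open import Data.Nat.ListAction using (sum)
open import Data.Nat.Properties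
open import Data.Nat.Tactic.RingSolver using (solve-∀)
open import Data.Product using (_×_; _,_; ∃; proj₁; proj₂; Σ-syntax)
open import Data.Refinement as Refinement using (_,_; value)
open import Data.Refinement.Properties using (value-injective)
open import Data.Sum.Base using (inj₁; inj₂)
open import Function.Base using (flip; _∘_; _on_; id)
open import Function.Bundles using (_⤖_; mk⤖; Bijection)
open import Function.Consequences.Propositional using (strictlySurjective⇒surjective)
open import Induction.WellFounded using (Acc; acc; module Subrelation)
open import Level using (0ℓ)
open import Relation.Binary.Construct.Closure.Equivalence.Properties using (a—↠b&a—↠c⇒b↔c)
open import Relation.Binary.Construct.Closure.ReflexiveTransitive using (Star; ε; _◅_; reverse; fold)
import Relation.Binary.Construct.On as On
open import Relation.Binary.Core using (Rel)
open import Relation.Binary.Definitions using (DecidableEquality; tri<; tri≈; tri>)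
open import Relation.Binary.PropositionalEquality
open import Relation.Binary.Rewriting
open import Relation.Nullary using (¬_; ¬?; Dec; yes; no; contradiction; recompute)
open import Relation.Nullary.Decidable using (decidable-stable; map′; _×-dec_)

-- Existence of normal forms

sn∧reducible?⇒wn : ∀ {a ℓ} {A : Set a} {_⟶_ : Rel A ℓ} → StronglyNormalizing _⟶_ →
                   (∀ x → Dec (∃ (x ⟶_))) → WeaklyNormalizing _⟶_
sn∧reducible?⇒wn {_⟶_ = _⟶_} sn reducible? x = normalize x (sn x)
  where
  normalize : ∀ x → Acc (flip _⟶_) x → HasNormalForm _⟶_ x
  normalize x (acc rs) with reducible? x
  ... | no irreducible = x , irreducible , ε
  ... | yes (y , x⟶y) with normalize y (rs x⟶y)
  ...   | z , normal , y↠z = z , normal , x⟶y ◅ y↠z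

-- Euclid's algorithm on solutions

-- (p , q , c , d) stands for (a , b , c , d) with a = d + suc p and b = c + suc q,
-- which makes a > d and b > c automatic; weight is then a b - c d.
State : Set
State = ℕ⁴

entries : State → ℕ⁴
entries (p , q , c , d) = d + suc p , c + suc q , c , d

weight : State → ℕ
weight (p , q , c , d) = d * suc q + c * suc p + suc p * suc q

infix 4 _↝_

-- Each rule adds one column to the other, giving `d + b` or `c + a` as the new off-diagonal entry,
-- while `(suc p , suc q)` undergoes a subtraction. The sums occur in equations and not in the
-- indices, so that two steps sharing a source or a target can be matched without unifying sums.
data _↝_ : Rel State 0ℓ where
  left  : ∀ {p p′ q c d d′} → p ≡ p′ + suc q → d′ ≡ d + (c + suc q) →
          (p , q , c , d) ↝ (p′ , q , c , d′)
  right : ∀ {p q q′ c c′ d} → q ≡ q′ + suc p → c′ ≡ c + (d + suc p) →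
          (p , q , c , d) ↝ (p , q′ , c′ , d)

-- The weight is a determinant, and adding a column to the other one preserves it.
weight-↝ : ∀ {s t} → s ↝ t → weight s ≡ weight t
weight-↝ (left {p′ = p} {q} {c} {d} refl refl) = lemma p q c d
  where
  lemma : ∀ p q c d → d * suc q + c * suc (p + suc q) + suc (p + suc q) * suc q
          ≡ (d + (c + suc q)) * suc q + c * suc p + suc p * suc q
  lemma = solve-∀
weight-↝ (right {p} {q′ = q} {c} {d = d} refl refl) = lemma p q c d
  where
  lemma : ∀ p q c d → d * suc (q + suc p) + c * suc p + suc p * suc (q + suc p)
          ≡ d * suc q + (c + (d + suc p)) * suc p + suc p * suc q
  lemma = solve-∀

weight-↝* : ∀ {s t} → Star _↝_ s t → weight s ≡ weight t
weight-↝* = fold (_≡_ on weight) (trans ∘ weight-↝) refl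

≢+suc+suc : ∀ {m n} k l → m ≡ k + suc n → n ≢ l + suc m
≢+suc+suc k l refl n≡ = m≢1+m+n _ (trans n≡ (lemma k l _))
  where
  lemma : ∀ k l n → l + suc (k + suc n) ≡ suc (n + suc (l + k))
  lemma = solve-∀

-- `left` requires `p > q` and `right` requires `q > p`, so at most one rule applies; its result is
-- then fixed by cancellation.
↝-deterministic : Deterministic _≡_ _↝_
↝-deterministic (left {p′ = p′} {q} eq refl) (left eq′ refl) =
  cong (_, _) (+-cancelʳ-≡ (suc q) p′ _ (trans (sym eq) eq′))
↝-deterministic (left eq _) (right eq′ _) = contradiction eq′ (≢+suc+suc _ _ eq)
↝-deterministic (right eq _) (left eq′ _) = contradiction eq (≢+suc+suc _ _ eq′)
↝-deterministic (right {p} {q′ = q′} eq refl) (right eq′ refl) =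
  cong (λ q → p , q , _) (+-cancelʳ-≡ (suc p) q′ _ (trans (sym eq) eq′))

≢+[+suc] : ∀ {c d} c′ d′ m n → d ≡ d′ + (c + suc m) → c ≢ c′ + (d + suc n)
≢+[+suc] {c} c′ d′ m n refl c≡ = m≢1+m+n c (trans c≡ (lemma c c′ d′ m n))
  where
  lemma : ∀ c c′ d′ m n → c′ + (d′ + (c + suc m) + suc n) ≡ suc (c + (suc (c′ + d′ + m + n)))
  lemma = solve-∀

-- A `left` step ends with `d ≥ b > c`, a `right` step with `c ≥ a > d`, so the target reveals the
-- last rule used.
↜-deterministic : Deterministic _≡_ (flip _↝_)
↜-deterministic (left {q = q} {c} {d} refl eq) (left refl eq′) =
  cong (λ d → _ , q , c , d) (+-cancelʳ-≡ (c + suc q) d _ (trans (sym eq) eq′))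
↜-deterministic (left {p} {q = q} {d = d} _ eq) (right {c = c} _ eq′) =
  contradiction eq′ (≢+[+suc] c d q _ eq)
↜-deterministic (right {c = c} _ eq) (left {q = q} {d = d} _ eq′) =
  contradiction eq (≢+[+suc] c d q _ eq′)
↜-deterministic (right {p} {c = c} {d = d} refl eq) (right refl eq′) =
  cong (λ c → p , _ , c , d) (+-cancelʳ-≡ (d + suc p) c _ (trans (sym eq) eq′))

↝-terminating : StronglyNormalizing _↝_
↝-terminating = Subrelation.wellFounded decreasing (On.wellFounded measure <-wellFounded)
  where
  measure : State → ℕ
  measure (p , q , _) = p + q
  decreasing : ∀ {t s} → s ↝ t → measure t < measure s
  decreasing (left {q = q} refl refl) = +-monoˡ-< q (m<m+n _ (s≤s z≤n))
  decreasing (right {p} refl refl) = +-monoʳ-< p (m<m+n _ (s≤s z≤n))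

-- Every forward step adds `b` or `a`, both positive, to `c + d`; going backwards, this sum falls.
↜-terminating : StronglyNormalizing (flip _↝_)
↜-terminating = Subrelation.wellFounded decreasing (On.wellFounded measure <-wellFounded)
  where
  measure : State → ℕ
  measure (_ , _ , c , d) = c + d
  decreasing : ∀ {s t} → s ↝ t → measure s < measure t
  decreasing (left {q = q} {c} {d} refl refl) = +-monoʳ-< c (m<m+n d (m<n⇒0<n (m<m+n c {suc q} (s≤s z≤n))))
  decreasing (right {p} {c = c} {d = d} refl refl) = +-monoˡ-< d (m<m+n c (m<n⇒0<n (m<m+n d {suc p} (s≤s z≤n))))

-- End points and starting points of the orbits

Diagonal : State → Set
Diagonal (p , q , _) = p ≡ q


diagonal⇒normal : ∀ s → Diagonal s → IsNormalForm _↝_ s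
diagonal⇒normal (p , _) refl (_ , left {p′ = p′} eq _) = <⇒≢ (m≤n+m (suc p) p′) eq
diagonal⇒normal (p , _) refl (_ , right {q′ = q′} eq _) = <⇒≢ (m≤n+m (suc p) q′) eq

¬diagonal⇒reducible : ∀ s → ¬ Diagonal s → ∃ (s ↝_)
¬diagonal⇒reducible (p , q , _) p≢q with <-cmp p q
... | tri< p<q _ _ = _ , right (sym (m∸n+n≡m p<q)) refl
... | tri≈ _ p≡q _ = contradiction p≡q p≢q
... | tri> _ _ p>q = _ , left (sym (m∸n+n≡m p>q)) refl

diagonal? : ∀ s → Dec (Diagonal s)
diagonal? (p , q , _) = p ≟ q

normal⇒diagonal : ∀ s → IsNormalForm _↝_ s → Diagonal s
normal⇒diagonal s normal = decidable-stable (diagonal? s) (normal ∘ ¬diagonal⇒reducible s)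

↝-normalizing : WeaklyNormalizing _↝_
↝-normalizing = sn∧reducible?⇒wn ↝-terminating λ s →
  map′ (¬diagonal⇒reducible s) (flip (diagonal⇒normal s)) (¬? (diagonal? s))

-- These are `c < a` and `d < b`. The other two inequalities contained in `c ⊔ d < a ⊓ b`, namely
-- `c < b` and `d < a`, hold in every state.
Reduced : State → Set
Reduced (p , q , c , d) = c < d + suc p × d < c + suc q

reduced⇒normal : ∀ s → Reduced s → IsNormalForm (flip _↝_) s
reduced⇒normal _ (_ , d<c+1+q) (_ , left {d = d} _ refl) = m+n≮n d _ d<c+1+q
reduced⇒normal _ (c<d+1+p , _) (_ , right {c = c} _ refl) = m+n≮n c _ c<d+1+p

¬reduced⇒reducible : ∀ s → ¬ Reduced s → ∃ (_↝ s)
¬reduced⇒reducible (p , q , c , d) ¬reduced with c <? d + suc p | d <? c + suc q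
... | yes c<d+1+p | yes d<c+1+q = contradiction (c<d+1+p , d<c+1+q) ¬reduced
-- Here `c ≥ a`, so subtracting `a` from `c` undoes a `right` step; in the next case `d ≥ b` and a
-- `left` step is undone.
... | no c≮d+1+p  | _           = _ , right {c = c ∸ (d + suc p)} refl (sym (m∸n+n≡m (≮⇒≥ c≮d+1+p)))
... | yes _       | no d≮c+1+q  = _ , left {d = d ∸ (c + suc q)} refl (sym (m∸n+n≡m (≮⇒≥ d≮c+1+q)))

reduced? : ∀ s → Dec (Reduced s)
reduced? (p , q , c , d) = c <? d + suc p ×-dec d <? c + suc q

normal⇒reduced : ∀ s → IsNormalForm (flip _↝_) s → Reduced s
normal⇒reduced s normal = decidable-stable (reduced? s) (normal ∘ ¬reduced⇒reducible s)

↜-normalizing : WeaklyNormalizing (flip _↝_)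
↜-normalizing = sn∧reducible?⇒wn ↜-terminating λ s →
  map′ (¬reduced⇒reducible s) (flip (reduced⇒normal s)) (¬? (reduced? s))

abstract
  -- The start of the orbit through `s`. It is abstract so that later proofs see only these two
  -- properties and the well-founded recursion never unfolds.
  reduction : ∀ s → ∃ λ r → Reduced r × Star _↝_ r s
  reduction s with r , normal , s↜*r ← ↜-normalizing s = r , normal⇒reduced r normal , reverse id s↜*r

reducedForm : State → State
reducedForm s = proj₁ (reduction s)

reducedForm-reduced : ∀ s → Reduced (reducedForm s)
reducedForm-reduced s = proj₁ (proj₂ (reduction s))

reducedForm↝* : ∀ s → Star _↝_ (reducedForm s) s
reducedForm↝* s = proj₂ (proj₂ (reduction s))

reducedForm-weight : ∀ s → weight (reducedForm s) ≡ weight s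
reducedForm-weight s = weight-↝* (reducedForm↝* s)

-- Both end points are forward normal forms of one common start, and a deterministic relation has
-- unique normal forms.
reducedForm-injective : ∀ {s t} → Diagonal s → Diagonal t → reducedForm s ≡ reducedForm t → s ≡ t
reducedForm-injective {s} {t} diag-s diag-t eq =
  conf⇒unf (det⇒conf ↝-deterministic) (diagonal⇒normal s diag-s) (diagonal⇒normal t diag-t)
    (a—↠b&a—↠c⇒b↔c (reducedForm↝* s) (subst (λ r → Star _↝_ r t) (sym eq) (reducedForm↝* t)))

-- Run the algorithm forward from `r` to its end `s`. Then `r` and `reducedForm s` are both backward
-- normal forms of `s`, hence equal.
reducedForm-surjective : ∀ {r} → Reduced r → ∃ λ s → Diagonal s × weight s ≡ weight r × reducedForm s ≡ r
reducedForm-surjective {r} reduced-r with ↝-normalizing r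
... | s , normal , r↝*s = s , normal⇒diagonal s normal , sym (weight-↝* r↝*s) ,
  conf⇒unf (det⇒conf ↜-deterministic)
    (reduced⇒normal _ (reducedForm-reduced s)) (reduced⇒normal r reduced-r)
    (a—↠b&a—↠c⇒b↔c (reverse id (reducedForm↝* s)) (reverse id r↝*s))

-- Enumeration of the end points

lookup-injective : ∀ {a} {A : Set a} {xs : List A} → Unique xs → ∀ {i j} → lookup xs i ≡ lookup xs j → i ≡ j
lookup-injective {xs = _ ∷ _} _            {zero}  {zero}  _  = refl
lookup-injective {xs = _ ∷ _} (x∉xs ∷ _)   {zero}  {suc j} eq = contradiction eq (All.lookup x∉xs (∈-lookup j))
lookup-injective {xs = _ ∷ _} (x∉xs ∷ _)   {suc i} {zero}  eq = contradiction (sym eq) (All.lookup x∉xs (∈-lookup i))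
lookup-injective {xs = _ ∷ _} (_ ∷ unique) {suc i} {suc j} eq = cong suc (lookup-injective unique eq)

module _ {a} {A : Set a} (f : A → ℕ) where

  -- A disjoint union of intervals, built so that its length is a sum of the kind found in
  -- `divisorSum`.
  initialSegments : List A → List (A × ℕ)
  initialSegments []       = []
  initialSegments (x ∷ xs) = map (x ,_) (upTo (f x)) ++ initialSegments xs

  length-initialSegments : ∀ xs → length (initialSegments xs) ≡ sum (map f xs)
  length-initialSegments []       = refl
  length-initialSegments (x ∷ xs) = trans (length-++ (map (x ,_) (upTo (f x))))
    (cong₂ _+_ (trans (length-map (x ,_) (upTo (f x))) (length-upTo (f x))) (length-initialSegments xs))

  ∈-initialSegments⁺ : ∀ {xs x i} → x ∈ xs → i < f x → (x , i) ∈ initialSegments xs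
  ∈-initialSegments⁺ (here refl)  i<fx = ∈-++⁺ˡ (∈-map⁺ _ (∈-upTo⁺ i<fx))
  ∈-initialSegments⁺ (there x∈xs) i<fx = ∈-++⁺ʳ _ (∈-initialSegments⁺ x∈xs i<fx)

  ∈-initialSegments⁻ : ∀ xs {x i} → (x , i) ∈ initialSegments xs → x ∈ xs × i < f x
  ∈-initialSegments⁻ (y ∷ xs) xi∈ with ∈-++⁻ (map (y ,_) (upTo (f y))) xi∈
  ... | inj₁ xi∈y with _ , i∈ , refl ← ∈-map⁻ _ xi∈y = here refl , ∈-upTo⁻ i∈
  ... | inj₂ xi∈xs with x∈xs , i<fx ← ∈-initialSegments⁻ xs xi∈xs = there x∈xs , i<fx

  initialSegments-unique : ∀ {xs} → Unique xs → Unique (initialSegments xs)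
  initialSegments-unique []                          = []
  initialSegments-unique {x ∷ xs} (x∉xs ∷ unique) =
    Unique.++⁺ (Unique.map⁺ (cong proj₂) (Unique.upTo⁺ (f x))) (initialSegments-unique unique)
      λ (∈x , ∈xs) → disjoint ∈x ∈xs
    where
    disjoint : ∀ {y} → y ∈ map (x ,_) (upTo (f x)) → ¬ y ∈ initialSegments xs
    disjoint ∈x ∈xs with _ , _ , refl ← ∈-map⁻ _ ∈x =
      All.lookup x∉xs (proj₁ (∈-initialSegments⁻ xs ∈xs)) refl

module Indices (n : ℕ) where

  large? : ∀ k → Dec (suc k ∣ n × n ≤ suc k * suc k)
  large? k = suc k ∣? n ×-dec n ≤? suc k * suc k

  largeDivisors : List ℕ
  largeDivisors = filter large? (upTo n)

  multiplicity : ℕ → ℕ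
  multiplicity k = (suc k + 1) ∸ n / suc k

  indices : List (ℕ × ℕ)
  indices = initialSegments multiplicity largeDivisors

  -- The filter and the summand used here agree definitionally with those of `divisorSum`.
  length-indices : length indices ≡ divisorSum n
  length-indices = length-initialSegments multiplicity largeDivisors

  indices-unique : Unique indices
  indices-unique = initialSegments-unique multiplicity (Unique.filter⁺ large? (Unique.upTo⁺ n))

  -- As in divisorSum, e stands for the divisor suc e, here equal to d + c + suc p.
  diagonal : ℕ × ℕ → State
  diagonal (e , d) = p , p , e ∸ (d + p) , d
    where p = pred (n / suc e)


  -- With `f = suc p` this is `(d + f) (c + f) - c d = f (d + c + f)`, the factorisation `n = f e`.
  weight-diagonal : ∀ p c d → weight (p , p , c , d) ≡ suc p * suc (d + c + p)
  weight-diagonal = lemma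
    where
    lemma : ∀ p c d → d * suc p + c * suc p + suc p * suc p ≡ suc p * suc (d + c + p)
    lemma = solve-∀

  rotate : ∀ c d p → c + (d + p) ≡ d + c + p
  rotate = solve-∀

  ∈-indices⁻ : ∀ {e d} → (e , d) ∈ indices →
               ∃ λ p → ∃ λ c → diagonal (e , d) ≡ (p , p , c , d) × e ≡ d + c + p × weight (p , p , c , d) ≡ n
  ∈-indices⁻ {e} {d} ed∈ with ∈-initialSegments⁻ multiplicity largeDivisors ed∈
  ... | e∈ , d<mult with ∈-filter⁻ large? {xs = upTo n} e∈
  -- A zero quotient would make `n` zero, and then `upTo n` is empty.
  ...   | e∈upTo , divides zero refl , _ = contradiction (∈-upTo⁻ e∈upTo) λ ()
  ...   | _ , divides (suc p) n≡ , _ =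
    p , c , cong (λ p → p , p , e ∸ (d + p) , d) (cong pred n/e≡1+p) , e≡ ,
    trans (weight-diagonal p c d) (sym (trans n≡ (cong (λ e → suc p * suc e) e≡)))
    where
    c = e ∸ (d + p)
    n/e≡1+p : n / suc e ≡ suc p
    n/e≡1+p = trans (cong (_/ suc e) n≡) (m*n/n≡m (suc p) (suc e))
    -- The bound on `d` makes the subtraction defining `c` exact: `(suc e + 1) ∸ suc p` reduces to
    -- `(e + 1) ∸ p`, which is at most `d` as soon as `e < d + p`.
    d+p≤e : d + p ≤ e
    d+p≤e = ≮⇒≥ λ e<d+p → <⇒≱ (subst (λ f → d < (suc e + 1) ∸ f) n/e≡1+p d<mult)
      (m≤n+o⇒m∸n≤o (e + 1) p (subst₂ _≤_ (+-comm 1 e) (+-comm d p) e<d+p))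
    e≡ : e ≡ d + c + p
    e≡ = trans (sym (m∸n+n≡m d+p≤e)) (rotate c d p)

  -- The cofactor `suc p` is a summand of `suc e = d + c + suc p`, hence at most `suc e`: this is
  -- the source of the condition that the square of the divisor be at least `n`. The bound on `d`
  -- expresses `c ≥ 0`.
  ∈-indices⁺ : ∀ s → Diagonal s → weight s ≡ n → ∃ λ i → i ∈ indices × diagonal i ≡ s
  ∈-indices⁺ (p , _ , c , d) refl weight≡n = (e , d) ,
    ∈-initialSegments⁺ multiplicity (∈-filter⁺ large? (∈-upTo⁺ e<n) (divides (suc p) n≡ , n≤e²)) d<mult ,
    trans (cong (λ f → pred f , pred f , e ∸ (d + pred f) , d) n/e≡1+p)
      (cong (λ c → p , p , c , d) (trans (cong (_∸ (d + p)) (sym (rotate c d p))) (m+n∸n≡m c (d + p))))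
    where
    e = d + c + p
    n≡ : n ≡ suc p * suc e
    n≡ = trans (sym weight≡n) (weight-diagonal p c d)
    n/e≡1+p : n / suc e ≡ suc p
    n/e≡1+p = trans (cong (_/ suc e) n≡) (m*n/n≡m (suc p) (suc e))
    e<n : e < n
    e<n = ≤-trans (m≤n*m (suc e) (suc p)) (≤-reflexive (sym n≡))
    n≤e² : n ≤ suc e * suc e
    n≤e² = ≤-trans (≤-reflexive n≡) (*-monoˡ-≤ (suc e) (s≤s (m≤n+m p (d + c))))
    d<mult : d < multiplicity e
    d<mult = subst (λ f → d < (suc e + 1) ∸ f) (sym n/e≡1+p)
      (m+n≤o⇒m≤o∸n (suc d) (subst (suc d + p ≤_) (+-comm 1 e) (s≤s (+-monoˡ-≤ p (m≤m+n d c)))))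

  -- The state displays `p`, `c` and `d`, and these determine `e = d + c + p`.
  diagonal-injective : ∀ {i j} → i ∈ indices → j ∈ indices → diagonal i ≡ diagonal j → i ≡ j
  diagonal-injective i∈ j∈ eq with ∈-indices⁻ i∈ | ∈-indices⁻ j∈
  ... | p , c , eqᵢ , refl , _ | p′ , c′ , eqⱼ , refl , _ with refl ← trans (sym eqᵢ) (trans eq eqⱼ) = refl

-- Solutions as reduced states

area : ℕ⁴ → ℤ
area (a , b , c , d) = + a ℤ.* + b ℤ.- + c ℤ.* + d

-- In ℕ, `a * b` expands to the weight plus `c * d`; only the cancellation of `c * d` takes place in
-- ℤ.
weight-entries : ∀ t → area (entries t) ≡ + weight t
weight-entries (p , q , c , d) = begin
  + a ℤ.* + b ℤ.- + c ℤ.* + d        ≡⟨ cong₂ ℤ._-_ (ℤ.pos-* a b) (ℤ.pos-* c d) ⟨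
  + (a * b) ℤ.- + (c * d)            ≡⟨ cong (λ m → + m ℤ.- + (c * d)) (expand p q c d) ⟩
  + (w + c * d) ℤ.- + (c * d)        ≡⟨ cong (ℤ._- + (c * d)) (ℤ.pos-+ w (c * d)) ⟩
  (+ w ℤ.+ + (c * d)) ℤ.- + (c * d)  ≡⟨ cancel (+ w) (+ (c * d)) ⟩
  + w                                  ∎
  where
  open ≡-Reasoning
  a = d + suc p
  b = c + suc q
  w = weight (p , q , c , d)
  expand : ∀ p q c d → (d + suc p) * (c + suc q) ≡ d * suc q + c * suc p + suc p * suc q + c * d
  expand = solve-∀
  cancel : ∀ i j → (i ℤ.+ j) ℤ.- j ≡ i
  cancel = ℤ-Solver.solve-∀

solution⇒entries : ∀ {n s} → IsSolution n s → ∃ λ t → Reduced t × weight t ≡ n × entries t ≡ s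
solution⇒entries {n} {a , b , c , d} (n≡ , c⊔d<a⊓b) = t ,
  (subst (c <_) (sym (cong proj₁ entries≡)) (m<n⊓o⇒m<n a b (m⊔n<o⇒m<o c d c⊔d<a⊓b)) ,
   subst (d <_) (sym (cong (proj₁ ∘ proj₂) entries≡)) (m<n⊓o⇒m<o a b (m⊔n<o⇒n<o c d c⊔d<a⊓b))) ,
  ℤ.+-injective (trans (sym (weight-entries t)) (trans (cong area entries≡) (sym n≡))) ,
  entries≡
  where
  -- Both subtractions are exact because `d < a` and `c < b`.
  t = a ∸ suc d , b ∸ suc c , c , d
  d<a = m<n⊓o⇒m<n a b (m⊔n<o⇒n<o c d c⊔d<a⊓b)
  c<b = m<n⊓o⇒m<o a b (m⊔n<o⇒m<o c d c⊔d<a⊓b)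
  +suc-∸ : ∀ {m k} → m < k → m + suc (k ∸ suc m) ≡ k
  +suc-∸ {m} {k} m<k = trans (+-suc m _) (m+[n∸m]≡n m<k)
  entries≡ : entries t ≡ (a , b , c , d)
  entries≡ = cong₂ (λ a b → a , b , c , d) (+suc-∸ d<a) (+suc-∸ c<b)

entries-solution : ∀ {n} t → Reduced t → weight t ≡ n → IsSolution n (entries t)
entries-solution t@(p , q , c , d) (c<a , d<b) refl = sym (weight-entries t) ,
  ⊔-lub (⊓-glb c<a (m<m+n c (s≤s z≤n))) (⊓-glb (m<m+n d (s≤s z≤n)) d<b)

entries-injective : ∀ {s t} → entries s ≡ entries t → s ≡ t
entries-injective {p , q , c , d} {p′ , q′ , c′ , d′} eq with refl ← cong (proj₂ ∘ proj₂) eq =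
  cong₂ (λ p q → p , q , c , d)
    (suc-injective (+-cancelˡ-≡ d _ _ (cong proj₁ eq)))
    (suc-injective (+-cancelˡ-≡ c _ _ (cong (proj₁ ∘ proj₂) eq)))

-- Decidability allows the irrelevant proof stored in a `Solution` to be recomputed.
isSolution? : ∀ n s → Dec (IsSolution n s)
isSolution? n (a , b , c , d) = _ ℤ.≟ _ ×-dec _ <? _

-- Counting the solutions

module _ (n : ℕ) where
  open Indices n

  diagonalOf : Fin (length indices) → State
  diagonalOf i = diagonal (lookup indices i)

  diagonalOf-spec : ∀ i → Diagonal (diagonalOf i) × weight (diagonalOf i) ≡ n
  diagonalOf-spec i with p , c , eq , _ , weight≡n ← ∈-indices⁻ (∈-lookup {xs = indices} i) =
    refl , trans (cong weight eq) weight≡n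

  -- An index gives an end point of the algorithm, and the start of its orbit is the solution.
  nthSolution : Fin (length indices) → Solution n
  nthSolution i = entries (reducedForm s) ,
    [ entries-solution (reducedForm s) (reducedForm-reduced s)
        (trans (reducedForm-weight s) (proj₂ (diagonalOf-spec i))) ]
    where s = diagonalOf i

  nthSolution-injective : ∀ {i j} → nthSolution i ≡ nthSolution j → i ≡ j
  nthSolution-injective {i} {j} eq = lookup-injective indices-unique
    (diagonal-injective (∈-lookup i) (∈-lookup j)
      (reducedForm-injective {diagonalOf i} {diagonalOf j} refl refl (entries-injective (cong value eq))))

  nthSolution-surjective : ∀ s → ∃ λ i → nthSolution i ≡ s
  nthSolution-surjective (s , [ proof ])
    with t , reduced , weight≡n , entries≡s ← solution⇒entries (recompute (isSolution? n s) proof)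
    with u , diag , weight≡ , reducedForm≡t ← reducedForm-surjective reduced
    with i , i∈ , diagonal≡u ← ∈-indices⁺ u diag (trans weight≡ weight≡n) =
    index i∈ , value-injective (begin
      entries (reducedForm (diagonalOf (index i∈)))  ≡⟨ cong (entries ∘ reducedForm ∘ diagonal) (lookup-index i∈) ⟨
      entries (reducedForm (diagonal i))             ≡⟨ cong (entries ∘ reducedForm) diagonal≡u ⟩
      entries (reducedForm u)                        ≡⟨ cong entries reducedForm≡t ⟩
      entries t                                      ≡⟨ entries≡s ⟩
      s                                              ∎)
    where open ≡-Reasoning

  enumeration : Fin (divisorSum n) ⤖ Solution n
  enumeration = subst (λ m → Fin m ⤖ Solution n) length-indices
    (mk⤖ (nthSolution-injective , strictlySurjective⇒surjective nthSolution-surjective))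

-- Euclid-reduced matrices

mat-cong : ∀ {a a′ b b′ c c′ d d′} → a ≡ a′ → b ≡ b′ → c ≡ c′ → d ≡ d′ → mat a b c d ≡ mat a′ b′ c′ d′
mat-cong refl refl refl refl = refl

mat-injective : ∀ {a a′ b b′ c c′ d d′} → mat a b c d ≡ mat a′ b′ c′ d′ → a ≡ a′ × b ≡ b′ × c ≡ c′ × d ≡ d′
mat-injective refl = refl , refl , refl , refl

infix 4 _≟ᴹ_

_≟ᴹ_ : DecidableEquality Matrix
mat a b c d ≟ᴹ mat a′ b′ c′ d′ =
  map′ (λ (a≡ , b≡ , c≡ , d≡) → mat-cong a≡ b≡ c≡ d≡) mat-injective
    (a ℤ.≟ a′ ×-dec b ℤ.≟ b′ ×-dec c ℤ.≟ c′ ×-dec d ℤ.≟ d′)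

module _ (α β γ δ : ℤ) where
  private
    M = mat α β γ δ

    1x-1y : ∀ x y → 1ℤ ℤ.* x ℤ.+ -1ℤ ℤ.* y ≡ x ℤ.- y
    1x-1y = ℤ-Solver.solve-∀
    -1x+1y : ∀ x y → -1ℤ ℤ.* x ℤ.+ 1ℤ ℤ.* y ≡ y ℤ.- x
    -1x+1y = ℤ-Solver.solve-∀
    0x+1y : ∀ x y → 0ℤ ℤ.* x ℤ.+ 1ℤ ℤ.* y ≡ y
    0x+1y = ℤ-Solver.solve-∀
    1x+0y : ∀ x y → 1ℤ ℤ.* x ℤ.+ 0ℤ ℤ.* y ≡ x
    1x+0y = ℤ-Solver.solve-∀
    x1+y0 : ∀ x y → x ℤ.* 1ℤ ℤ.+ y ℤ.* 0ℤ ≡ x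
    x1+y0 = ℤ-Solver.solve-∀
    x0+y1 : ∀ x y → x ℤ.* 0ℤ ℤ.+ y ℤ.* 1ℤ ≡ y
    x0+y1 = ℤ-Solver.solve-∀
    x-1+y1 : ∀ x y → x ℤ.* -1ℤ ℤ.+ y ℤ.* 1ℤ ≡ y ℤ.- x
    x-1+y1 = ℤ-Solver.solve-∀
    x1+y-1 : ∀ x y → x ℤ.* 1ℤ ℤ.+ y ℤ.* -1ℤ ≡ x ℤ.- y
    x1+y-1 = ℤ-Solver.solve-∀

  E·≡ : E · M ≡ mat (α ℤ.- γ) (β ℤ.- δ) γ δ
  E·≡ = mat-cong (1x-1y α γ) (1x-1y β δ) (0x+1y α γ) (0x+1y β δ)

  Eᵗ·≡ : E ᵗ · M ≡ mat α β (γ ℤ.- α) (δ ℤ.- β)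
  Eᵗ·≡ = mat-cong (1x+0y α γ) (1x+0y β δ) (-1x+1y α γ) (-1x+1y β δ)

  ·E≡ : M · E ≡ mat α (β ℤ.- α) γ (δ ℤ.- γ)
  ·E≡ = mat-cong (x1+y0 α β) (x-1+y1 α β) (x1+y0 γ δ) (x-1+y1 γ δ)

  ·Eᵗ≡ : M · E ᵗ ≡ mat (α ℤ.- β) β (γ ℤ.- δ) δ
  ·Eᵗ≡ = mat-cong (x1+y-1 α β) (x0+y1 α β) (x1+y-1 γ δ) (x0+y1 γ δ)

-- `E` has determinant 1. By this and the three analogues below, a reduction of a matrix in `𝒫` can
-- leave `𝒫` only through a negative entry.
det-E· : ∀ α β γ δ → det (mat α β γ δ) ≡ det (mat (α ℤ.- γ) (β ℤ.- δ) γ δ)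
det-E· = expand
  where
  expand : ∀ α β γ δ → α ℤ.* δ ℤ.- β ℤ.* γ ≡ (α ℤ.- γ) ℤ.* δ ℤ.- (β ℤ.- δ) ℤ.* γ
  expand = ℤ-Solver.solve-∀

det-Eᵗ· : ∀ α β γ δ → det (mat α β γ δ) ≡ det (mat α β (γ ℤ.- α) (δ ℤ.- β))
det-Eᵗ· = expand
  where
  expand : ∀ α β γ δ → α ℤ.* δ ℤ.- β ℤ.* γ ≡ α ℤ.* (δ ℤ.- β) ℤ.- β ℤ.* (γ ℤ.- α)
  expand = ℤ-Solver.solve-∀

det-·E : ∀ α β γ δ → det (mat α β γ δ) ≡ det (mat α (β ℤ.- α) γ (δ ℤ.- γ))
det-·E = expand
  where
  expand : ∀ α β γ δ → α ℤ.* δ ℤ.- β ℤ.* γ ≡ α ℤ.* (δ ℤ.- γ) ℤ.- (β ℤ.- α) ℤ.* γ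
  expand = ℤ-Solver.solve-∀

det-·Eᵗ : ∀ α β γ δ → det (mat α β γ δ) ≡ det (mat (α ℤ.- β) β (γ ℤ.- δ) δ)
det-·Eᵗ = expand
  where
  expand : ∀ α β γ δ → α ℤ.* δ ℤ.- β ℤ.* γ ≡ (α ℤ.- β) ℤ.* δ ℤ.- β ℤ.* (γ ℤ.- δ)
  expand = ℤ-Solver.solve-∀

0≤+ : ∀ {m} → 0ℤ ℤ.≤ + m
0≤+ = ℤ.+≤+ z≤n

n≤m⇒0≤m-n : ∀ {m n} → n ≤ m → 0ℤ ℤ.≤ + m ℤ.- + n
n≤m⇒0≤m-n n≤m = ℤ.i≤j⇒0≤j-i (ℤ.+≤+ n≤m)

0≤m-n⇒n≤m : ∀ {m n} → 0ℤ ℤ.≤ + m ℤ.- + n → n ≤ m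
0≤m-n⇒n≤m 0≤m-n = ℤ.drop‿+≤+ (ℤ.0≤i-j⇒j≤i 0≤m-n)

0<area⇒cd<ab : ∀ a b c d → 0ℤ ℤ.< + a ℤ.* + b ℤ.- + c ℤ.* + d → c * d < a * b
0<area⇒cd<ab a b c d 0<area = ≰⇒> λ ab≤cd → ℤ.<⇒≱ 0<area
  (ℤ.i≤j⇒i-j≤0 (subst₂ ℤ._≤_ (ℤ.pos-* a b) (ℤ.pos-* c d) (ℤ.+≤+ ab≤cd)))

-- Otherwise `x < z` and `w ≤ y` give `x * w ≤ y * z`. With a positive determinant, one comparison
-- between two rows or columns thus forces the other, so that the whole row or column can be
-- subtracted.
*-<⇒≤⇒≤ : ∀ {x y z w} → y * z < x * w → w ≤ y → z ≤ x
*-<⇒≤⇒≤ {y = y} {z} yz<xw w≤y = ≮⇒≥ λ x<z →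
  <⇒≱ yz<xw (≤-trans (*-mono-≤ (<⇒≤ x<z) w≤y) (≤-reflexive (*-comm z y)))

module _ {a b c d : ℕ} where

  private
    M = toMatrix (a , b , c , d)

  -- Each of the four inequalities is tied to one reduction: if it fails, that reduction stays in
  -- `𝒫`.
  euclidReduced⇒⊔<⊓ : EuclidReduced M → c ⊔ d < a ⊓ b
  euclidReduced⇒⊔<⊓ (M∈𝒫 , irreducible) = ⊔-lub (⊓-glb c<a c<b) (⊓-glb d<a d<b)
    where
    open 𝒫 M∈𝒫
    cd<ab : c * d < a * b
    cd<ab = 0<area⇒cd<ab a b c d 0<det
    c<b : c < b
    c<b = ≰⇒> λ b≤c → irreducible _ (here refl) (subst 𝒫 (sym (E·≡ (+ a) (+ c) (+ d) (+ b))) record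
      { 0≤α = n≤m⇒0≤m-n (*-<⇒≤⇒≤ cd<ab b≤c)
      ; 0≤β = n≤m⇒0≤m-n b≤c
      ; 0≤γ = 0≤+
      ; 0≤δ = 0≤+
      ; 0<det = subst (0ℤ ℤ.<_) (det-E· (+ a) (+ c) (+ d) (+ b)) 0<det
      })
    d<a : d < a
    d<a = ≰⇒> λ a≤d → irreducible _ (there (here refl)) (subst 𝒫 (sym (Eᵗ·≡ (+ a) (+ c) (+ d) (+ b))) record
      { 0≤α = 0≤+
      ; 0≤β = 0≤+
      ; 0≤γ = n≤m⇒0≤m-n a≤d
      ; 0≤δ = n≤m⇒0≤m-n (*-<⇒≤⇒≤ (subst₂ _<_ (*-comm c d) (*-comm a b) cd<ab) a≤d)
      ; 0<det = subst (0ℤ ℤ.<_) (det-Eᵗ· (+ a) (+ c) (+ d) (+ b)) 0<det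
      })
    c<a : c < a
    c<a = ≰⇒> λ a≤c → irreducible _ (there (there (here refl))) (subst 𝒫 (sym (·E≡ (+ a) (+ c) (+ d) (+ b))) record
      { 0≤α = 0≤+
      ; 0≤β = n≤m⇒0≤m-n a≤c
      ; 0≤γ = 0≤+
      ; 0≤δ = n≤m⇒0≤m-n (*-<⇒≤⇒≤ (subst (c * d <_) (*-comm a b) cd<ab) a≤c)
      ; 0<det = subst (0ℤ ℤ.<_) (det-·E (+ a) (+ c) (+ d) (+ b)) 0<det
      })
    d<b : d < b
    d<b = ≰⇒> λ b≤d → irreducible _ (there (there (there (here refl)))) (subst 𝒫 (sym (·Eᵗ≡ (+ a) (+ c) (+ d) (+ b))) record
      { 0≤α = n≤m⇒0≤m-n (*-<⇒≤⇒≤ (subst (_< a * b) (*-comm c d) cd<ab) b≤d)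
      ; 0≤β = 0≤+
      ; 0≤γ = n≤m⇒0≤m-n b≤d
      ; 0≤δ = 0≤+
      ; 0<det = subst (0ℤ ℤ.<_) (det-·Eᵗ (+ a) (+ c) (+ d) (+ b)) 0<det
      })

  -- Each reduction acquires a negative entry: `c - b`, `d - a`, `c - a` and `d - b` respectively.
  ⊔<⊓⇒euclidReduced : 0ℤ ℤ.< det M → c ⊔ d < a ⊓ b → EuclidReduced M
  ⊔<⊓⇒euclidReduced 0<det c⊔d<a⊓b =
    record { 0≤α = 0≤+ ; 0≤β = 0≤+ ; 0≤γ = 0≤+ ; 0≤δ = 0≤+ ; 0<det = 0<det } , irreducible
    where
    c<a⊓b : c < a ⊓ b
    c<a⊓b = m⊔n<o⇒m<o c d c⊔d<a⊓b
    d<a⊓b : d < a ⊓ b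
    d<a⊓b = m⊔n<o⇒n<o c d c⊔d<a⊓b
    irreducible : ∀ N → N ∈ elementaryReductions M → ¬ 𝒫 N
    irreducible _ (here refl) N∈𝒫 =
      <⇒≱ (m<n⊓o⇒m<o a b c<a⊓b) (0≤m-n⇒n≤m (𝒫.0≤β (subst 𝒫 (E·≡ (+ a) (+ c) (+ d) (+ b)) N∈𝒫)))
    irreducible _ (there (here refl)) N∈𝒫 =
      <⇒≱ (m<n⊓o⇒m<n a b d<a⊓b) (0≤m-n⇒n≤m (𝒫.0≤γ (subst 𝒫 (Eᵗ·≡ (+ a) (+ c) (+ d) (+ b)) N∈𝒫)))
    irreducible _ (there (there (here refl))) N∈𝒫 =
      <⇒≱ (m<n⊓o⇒m<n a b c<a⊓b) (0≤m-n⇒n≤m (𝒫.0≤β (subst 𝒫 (·E≡ (+ a) (+ c) (+ d) (+ b)) N∈𝒫)))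
    irreducible _ (there (there (there (here refl)))) N∈𝒫 =
      <⇒≱ (m<n⊓o⇒m<o a b d<a⊓b) (0≤m-n⇒n≤m (𝒫.0≤γ (subst 𝒫 (·Eᵗ≡ (+ a) (+ c) (+ d) (+ b)) N∈𝒫)))

-- The correspondence between solutions and Euclid-reduced matrices

toMatrix-injective : ∀ {s t} → toMatrix s ≡ toMatrix t → s ≡ t
toMatrix-injective refl = refl

-- Inverse to `toMatrix` on matrices with entries in ℕ. Being total, it yields a preimage without
-- inspecting an irrelevant membership proof.
abs⁴ : Matrix → ℕ⁴
abs⁴ (mat α β γ δ) = ℤ.∣ α ∣ , ℤ.∣ δ ∣ , ℤ.∣ β ∣ , ℤ.∣ γ ∣

𝒫⇒toMatrix-abs⁴ : ∀ {M} → 𝒫 M → toMatrix (abs⁴ M) ≡ M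
𝒫⇒toMatrix-abs⁴ M∈𝒫 = mat-cong (ℤ.0≤i⇒+∣i∣≡i 0≤α) (ℤ.0≤i⇒+∣i∣≡i 0≤β) (ℤ.0≤i⇒+∣i∣≡i 0≤γ) (ℤ.0≤i⇒+∣i∣≡i 0≤δ)
  where open 𝒫 M∈𝒫

module _ {n : ℕ} (n≥1 : n ≥ 1) where

  -- The hypothesis `n ≥ 1` supplies the positive determinant required by `𝒫`.
  solution⇒ℛ : ∀ s → IsSolution n s → EuclidReduced (toMatrix s) × det (toMatrix s) ≡ + n
  solution⇒ℛ _ (n≡ , c⊔d<a⊓b) = ⊔<⊓⇒euclidReduced (subst (0ℤ ℤ.<_) n≡ (ℤ.+<+ n≥1)) c⊔d<a⊓b , sym n≡

  ℛ⇒solution : ∀ s → EuclidReduced (toMatrix s) × det (toMatrix s) ≡ + n → IsSolution n s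
  ℛ⇒solution _ (reduced , det≡n) = sym det≡n , euclidReduced⇒⊔<⊓ reduced

  toℛ : Solution n → ℛ n
  toℛ = Refinement.map toMatrix (solution⇒ℛ _)

  toℛ-injective : ∀ {s t} → toℛ s ≡ toℛ t → s ≡ t
  toℛ-injective eq = value-injective (toMatrix-injective (cong value eq))

  toℛ-surjective : ∀ M → ∃ λ s → toℛ s ≡ M
  toℛ-surjective (M , proof) = (abs⁴ M , Irrelevant.map solves proof) , value-injective (toMatrix-abs proof)
    where
    solves : EuclidReduced M × det M ≡ + n → IsSolution n (abs⁴ M)
    solves p@((M∈𝒫 , _) , _) = ℛ⇒solution (abs⁴ M)
      (subst (λ M → EuclidReduced M × det M ≡ + n) (sym (𝒫⇒toMatrix-abs⁴ M∈𝒫)) p)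
    toMatrix-abs : Irrelevant (EuclidReduced M × det M ≡ + n) → toMatrix (abs⁴ M) ≡ M
    -- Equality of matrices is decidable, so it may be derived from an irrelevant proof.
    toMatrix-abs [ p ] = recompute (_ ≟ᴹ _) (𝒫⇒toMatrix-abs⁴ (proj₁ (proj₁ p)))

theorem1p1 : (n : ℕ) → n ≥ 1 →
    (Fin (divisorSum n) ⤖ Solution n)
    × (Σ[ φ ∈ Solution n ⤖ ℛ n ] ((s : Solution n) → value (Bijection.to φ s) ≡ toMatrix (value s)))
theorem1p1 n n≥1 = enumeration n , mk⤖ (toℛ-injective n≥1 , strictlySurjective⇒surjective (toℛ-surjective n≥1)) , λ _ → refl
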